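{- Let $\Sigma_1=(G_1,\sigma_1)$ be a finite, simple, connected, balanced signed graph and let $\Sigma_2=(K_n,\sigma_2)$ be a signed complete graph. Then the BCD-lexicographic product satisfies $\operatorname{bdim}(\Sigma_1*\Sigma_2)=\operatorname{bdim}(\Sigma_2)$.
   Context: A signed graph $\Sigma=(G,\sigma)$ is a graph $G=(V,E)$ with a function $\sigma:E\to\{+1,-1\}$. All graphs are finite, simple, connected and undirected unless otherwise mentioned. The sign of a cycle is the product of the signs of its edges; $\Sigma$ is balanced if it has no cycle of sign $-1$. A signed complete graph is a signed graph whose underlying graph is a complete graph $K_n$ (with arbitrary signature). Let $\Omega=\{ -1,0,1\}$, with $\Omega^k\subset\mathbb{R}^k$ carrying the standard inner product $\langle\cdot,\cdot\rangle$. A vector valued switching function ($k$-switching function) for $\Sigma$ is a map $\zeta:V\to\Omega^k$ with $\langle\zeta(u),\zeta(v)\rangle\neq 0$ for every edge $uv\in E$; the switched signed graph $\Sigma^\zeta=(G,\sigma^\zeta)$ has $\sigma^\zeta(uv)=\sigma(uv)\operatorname{sgn}(\langle\zeta(u),\zeta(v)\rangle)$. The balancing dimension $\operatorname{bdim}(\Sigma)$ is the least integer $k\ge 1$ for which there is a $k$-switching function $\zeta:V\to\Omega^k$ such that $\Sigma^\zeta$ is all-positive (every edge has sign $+1$). The lexicographic product of graphs $G_1,G_2$ has vertex set $V(G_1)\times V(G_2)$, with $(u_i,v_j)$ adjacent to $(u_k,v_l)$ iff $u_i\sim u_k$ in $G_1$, or $u_i=u_k$ and $v_j\sim v_l$ in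 $G_2$. The BCD-lexicographic product $\Sigma_1*\Sigma_2$ of $\Sigma_1=(G_1,\sigma_1)$ and $\Sigma_2=(G_2,\sigma_2)$ is the signed graph on this lexicographic product with signature $$\sigma((u_i,v_j)(u_k,v_l))=\begin{cases}\sigma_1(u_iu_k) & \text{if } u_i\sim u_k \text{ and } v_j\nsim v_l,\\ \sigma_1(u_iu_k)\sigma_2(v_jv_l) & \text{if } u_i\sim u_k\text{ and } v_j\sim v_l,\\ \sigma_2(v_jv_l) & \text{if } u_i=u_k \text{ and } v_j\sim v_l,\end{cases}$$ where $v_j\nsim v_l$ includes the case $v_j=v_l$. -}

module Defs where

open import Data.Empty using (⊥-elim)
open import Data.Fin.Base using (Fin)
import Data.Fin.Properties as Fin
open import Data.Integer.Base as ℤ using (ℤ; 0ℤ; 1ℤ; -1ℤ; _◃_)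
import Data.Integer.Properties as ℤ
open import Data.List.Base using (List; []; _∷_)
open import Data.List.Relation.Unary.Unique.Propositional using (Unique)
open import Data.Nat.Base as ℕ using (ℕ; zero; suc; _≤_; _<_; z≤n; s≤s)
open import Data.Nat.Induction using (<-rec)
import Data.Nat.Properties as ℕ
open import Data.Product.Base using (∃; _×_; _,_; proj₁; proj₂)
open import Data.Product.Function.NonDependent.Propositional using (_×-↔_)
open import Data.Sign.Base as Sign using (Sign)
import Data.Sign.Properties as Sign
open import Data.Sum.Base using (_⊎_; inj₁; inj₂)
open import Data.Vec.Base using (Vec; []; _∷_; lookup; tabulate; map; allPairs)
open import Data.Vec.Membership.Propositional using (_∈_)
open import Data.Vec.Membership.Propositional.Properties
  using (∈-tabulate⁺; ∈-allPairs⁺)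
open import Data.Vec.Properties using (lookup∘tabulate)
open import Data.Vec.Relation.Unary.Any using (here; there)
open import Function.Base using (_∘_)
open import Function.Bundles using (_↔_; Inverse)
open import Function.Construct.Composition using (_↔-∘_)
open import Function.Construct.Identity using (↔-id)
open import Function.Construct.Symmetry using (↔-sym)
open import Function.Properties.Inverse using (Inverse⇒Injection)
open import Relation.Binary.Construct.Closure.ReflexiveTransitive using (Star; ε; _◅_)
open import Relation.Binary.Definitions using (Decidable; DecidableEquality)
open import Relation.Binary.PropositionalEquality
  using (_≡_; _≢_; refl; sym; trans; cong; cong₂; subst)
open import Relation.Nullary.Decidable
  using (Dec; yes; no; map′; ¬?; _×-dec_; _⊎-dec_)
open import Relation.Nullary.Negation using (¬_; contradiction)
import Relation.Unary as Unary

------------------------------------------------------------------------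
-- Graphs

-- Adjacency of a finite graph is decidable classically; constructively this
-- has to be part of the data.

record Graph : Set₁ where
  infix 4 _~_ _~?_ _≟_
  field
    V        : Set
    order    : ℕ
    finite   : V ↔ Fin order
    _~_      : V → V → Set
    _~?_     : Decidable _~_
    ~-sym    : ∀ {u v} → u ~ v → v ~ u
    ~-irrefl : ∀ {v} → ¬ (v ~ v)

  _≟_ : DecidableEquality V
  _≟_ = Fin.inj⇒≟ (Inverse⇒Injection finite)

  Walk : V → V → Set
  Walk = Star _~_

  length : ∀ {u v} → Walk u v → ℕ
  length ε       = 0
  length (_ ◅ w) = suc (length w)

  vertices : ∀ {u v} → Walk u v → List V
  vertices {u} ε       = u ∷ []
  vertices {u} (_ ◅ w) = u ∷ vertices w

-- The empty graph is not connected.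

Connected : Graph → Set
Connected G = V × (∀ u v → Walk u v)
  where open Graph G

K : ℕ → Graph
K n = record
  { V        = Fin n
  ; order    = n
  ; finite   = ↔-id (Fin n)
  ; _~_      = _≢_
  ; _~?_     = λ i j → ¬? (i Fin.≟ j)
  ; ~-sym    = λ i≢j j≡i → i≢j (sym j≡i)
  ; ~-irrefl = λ i≢i → i≢i refl
  }

-- A cycle: a path of length at least 2 closed up by one further edge.

record Cycle (G : Graph) : Set where
  open Graph G
  field
    {start end} : V
    path        : Walk start end
    distinct    : Unique (vertices path)
    long        : 2 ≤ length path
    closing     : end ~ start

infixl 7 _[_]

_[_] : Graph → Graph → Graph
G₁ [ G₂ ] = record
  { V        = G₁.V × G₂.V
  ; order    = G₁.order ℕ.* G₂.order
  ; finite   = ↔-sym Fin.*↔× ↔-∘ (G₁.finite ×-↔ G₂.finite)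
  ; _~_      = λ (u , v) (u′ , v′) → u G₁.~ u′ ⊎ (u ≡ u′ × v G₂.~ v′)
  ; _~?_     = λ (u , v) (u′ , v′) →
                 (u G₁.~? u′) ⊎-dec ((u G₁.≟ u′) ×-dec (v G₂.~? v′))
  ; ~-sym    = λ { (inj₁ p)          → inj₁ (G₁.~-sym p)
                 ; (inj₂ (u≡u′ , q)) → inj₂ (sym u≡u′ , G₂.~-sym q) }
  ; ~-irrefl = λ { (inj₁ p)       → G₁.~-irrefl p
                 ; (inj₂ (_ , q)) → G₂.~-irrefl q }
  }
  where
  module G₁ = Graph G₁
  module G₂ = Graph G₂

------------------------------------------------------------------------
-- Signed graphs

-- The signed graphs with underlying graph G, i.e. the signatures on its edges.
-- As σ-sym takes an arbitrary proof of each adjacency, it also makes the sign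
-- of an edge independent of the adjacency proof (see σ-irr).

record SignedGraph (G : Graph) : Set where
  open Graph G
  field
    σ     : ∀ {u v} → u ~ v → Sign
    σ-sym : ∀ {u v} (p : u ~ v) (q : v ~ u) → σ p ≡ σ q

  σ-irr : ∀ {u v} (p q : u ~ v) → σ p ≡ σ q
  σ-irr p q = trans (σ-sym p (~-sym p)) (σ-sym (~-sym p) q)

  walkSign : ∀ {u v} → Walk u v → Sign
  walkSign ε       = Sign.+
  walkSign (p ◅ w) = σ p Sign.* walkSign w

  cycleSign : Cycle G → Sign
  cycleSign c = σ closing Sign.* walkSign path
    where open Cycle c

module _ {G : Graph} where

  Balanced : SignedGraph G → Set
  Balanced Σ = ¬ ∃ λ (c : Cycle G) → cycleSign c ≡ Sign.-
    where open SignedGraph Σ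

  AllPositive : SignedGraph G → Set
  AllPositive Σ = ∀ {u v} (p : u ~ v) → σ p ≡ Sign.+
    where
    open Graph G
    open SignedGraph Σ

-- The BCD-lexicographic product.

module _ {G₁ G₂ : Graph} where
  private
    module G₁ = Graph G₁
    module G₂ = Graph G₂
    open Graph (G₁ [ G₂ ]) using (_~_)

  infixl 7 _⋆_

  _⋆_ : SignedGraph G₁ → SignedGraph G₂ → SignedGraph (G₁ [ G₂ ])
  Σ₁ ⋆ Σ₂ = record { σ = σ ; σ-sym = σ-sym }
    where
    module Σ₁ = SignedGraph Σ₁
    module Σ₂ = SignedGraph Σ₂

    σ : ∀ {x y} → x ~ y → Sign
    σ {u , v} {u′ , v′} (inj₁ p) with v G₂.~? v′
    ... | yes q = Σ₁.σ p Sign.* Σ₂.σ q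
    ... | no  _ = Σ₁.σ p
    σ (inj₂ (_ , q)) = Σ₂.σ q

    σ-sym : ∀ {x y} (p : x ~ y) (q : y ~ x) → σ p ≡ σ q
    σ-sym {u , v} {u′ , v′} (inj₁ p) (inj₁ p′) with v G₂.~? v′ | v′ G₂.~? v
    ... | yes q | yes q′ = cong₂ Sign._*_ (Σ₁.σ-sym p p′) (Σ₂.σ-sym q q′)
    ... | yes q | no ¬q′ = contradiction (G₂.~-sym q) ¬q′
    ... | no ¬q | yes q′ = contradiction (G₂.~-sym q′) ¬q
    ... | no _  | no _   = Σ₁.σ-sym p p′
    σ-sym (inj₁ p)          (inj₂ (refl , _)) = contradiction p G₁.~-irrefl
    σ-sym (inj₂ (refl , _)) (inj₁ p)          = contradiction p G₁.~-irrefl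
    σ-sym (inj₂ (_ , q))    (inj₂ (_ , q′))   = Σ₂.σ-sym q q′

------------------------------------------------------------------------
-- Vector valued switching

data Ω : Set where
  -1Ω 0Ω 1Ω : Ω

toℤ : Ω → ℤ
toℤ -1Ω = -1ℤ
toℤ 0Ω  = 0ℤ
toℤ 1Ω  = 1ℤ

⟨_,_⟩ : ∀ {k} → Vec Ω k → Vec Ω k → ℤ
⟨ []    , []    ⟩ = 0ℤ
⟨ a ∷ x , b ∷ y ⟩ = toℤ a ℤ.* toℤ b ℤ.+ ⟨ x , y ⟩

⟨⟩-comm : ∀ {k} (x y : Vec Ω k) → ⟨ x , y ⟩ ≡ ⟨ y , x ⟩
⟨⟩-comm []      []      = refl
⟨⟩-comm (a ∷ x) (b ∷ y) = cong₂ ℤ._+_ (ℤ.*-comm (toℤ a) (toℤ b)) (⟨⟩-comm x y)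

record SwitchingFunction (G : Graph) (k : ℕ) : Set where
  open Graph G
  field
    ζ       : V → Vec Ω k
    nonzero : ∀ {u v} → u ~ v → ⟨ ζ u , ζ v ⟩ ≢ 0ℤ

-- ℤ.sign 0ℤ is Sign.+, but the inner product is nonzero on every edge.

switch : ∀ {G k} → SignedGraph G → SwitchingFunction G k → SignedGraph G
switch Σ Z = record
  { σ     = λ {u} {v} p → σ p Sign.* ℤ.sign ⟨ ζ u , ζ v ⟩
  ; σ-sym = λ {u} {v} p q →
              cong₂ Sign._*_ (σ-sym p q) (cong ℤ.sign (⟨⟩-comm (ζ u) (ζ v)))
  }
  where
  open SignedGraph Σ
  open SwitchingFunction Z

------------------------------------------------------------------------
-- Balancing dimension

module _ {G : Graph} (Σ : SignedGraph G) where
  open Graph G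
  open SignedGraph Σ

  Balanceable : ℕ → Set
  Balanceable k = ∃ λ (Z : SwitchingFunction G k) → AllPositive (switch Σ Z)

  record IsBdim (k : ℕ) : Set where
    field
      positive    : 1 ≤ k
      balanceable : Balanceable k
      minimal     : ∀ j → 1 ≤ j → Balanceable j → k ≤ j

-- The rest shows that a least such k exists: Balanceable is decidable by
-- exhaustive search, and it holds for k = 1 + order².

private
  Searchable : Set → Set₁
  Searchable A = ∀ {P : A → Set} → Unary.Decidable P → Dec (∃ P)

  searchΩ : Searchable Ω
  searchΩ {P} P? = map′ to from (P? -1Ω ⊎-dec (P? 0Ω ⊎-dec P? 1Ω))
    where
    to : P -1Ω ⊎ (P 0Ω ⊎ P 1Ω) → ∃ P
    to (inj₁ p)        = -1Ω , p
    to (inj₂ (inj₁ p)) = 0Ω , p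
    to (inj₂ (inj₂ p)) = 1Ω , p
    from : ∃ P → P -1Ω ⊎ (P 0Ω ⊎ P 1Ω)
    from (-1Ω , p) = inj₁ p
    from (0Ω  , p) = inj₂ (inj₁ p)
    from (1Ω  , p) = inj₂ (inj₂ p)

  searchVec : ∀ {A} → Searchable A → ∀ n → Searchable (Vec A n)
  searchVec s zero    P? = map′ ([] ,_) (λ { ([] , p) → p }) (P? [])
  searchVec s (suc n) P? =
    map′ (λ { (a , x , p) → a ∷ x , p })
         (λ { (a ∷ x , p) → a , x , p })
         (s (λ a → searchVec s n (λ x → P? (a ∷ x))))

  least : {P : ℕ → Set} → Unary.Decidable P → ∀ n → P n →
          ∃ λ k → P k × (∀ j → P j → k ≤ j)
  least {P} P? = <-rec _ step
    where
    step : ∀ n → (∀ {m} → m < n → P m → ∃ λ k → P k × (∀ j → P j → k ≤ j)) →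
           P n → ∃ λ k → P k × (∀ j → P j → k ≤ j)
    step n rec pn with ℕ.anyUpTo? P? n
    ... | yes (m , m<n , pm) = rec m<n pm
    ... | no  none           =
      n , pn , λ j pj → ℕ.≮⇒≥ (λ j<n → none (j , j<n , pj))

  ◃-suc : ∀ s m → (s ◃ 1) ℤ.+ (s ◃ m) ≡ s ◃ suc m
  ◃-suc s m = sym (ℤ.◃-distrib-+ s 1 m)

  module _ {G : Graph} (Σ : SignedGraph G) where
    open Graph G
    open SignedGraph Σ
    open Inverse finite using (to; from; strictlyInverseʳ)

    ∀V? : {P : V → Set} → Unary.Decidable P → Dec (∀ v → P v)
    ∀V? {P} P? = map′ (λ f v → subst P (strictlyInverseʳ v) (f (to v)))
                      (λ f i → f (from i))
                      (Fin.all? (P? ∘ from))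

    Good : ∀ {k} → (V → Vec Ω k) → V → V → Set
    Good ζ u v = (p : u ~ v) →
      ⟨ ζ u , ζ v ⟩ ≢ 0ℤ × σ p Sign.* ℤ.sign ⟨ ζ u , ζ v ⟩ ≡ Sign.+

    good? : ∀ {k} (ζ : V → Vec Ω k) u v → Dec (Good ζ u v)
    good? ζ u v with u ~? v
    ... | no ¬p = yes (λ p → contradiction p ¬p)
    ... | yes p = map′
      (λ (a , b) q → a , trans (cong (Sign._* _) (σ-irr q p)) b) (λ f → f p)
      (¬? (⟨ ζ u , ζ v ⟩ ℤ.≟ 0ℤ) ×-dec
       (σ p Sign.* ℤ.sign ⟨ ζ u , ζ v ⟩ Sign.≟ Sign.+))

    good⇒balanceable : ∀ {k} (ζ : V → Vec Ω k) → (∀ u v → Good ζ u v) →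
                       Balanceable Σ k
    good⇒balanceable ζ g =
      record { ζ = ζ ; nonzero = λ p → proj₁ (g _ _ p) } ,
      λ p → proj₂ (g _ _ p)

    balanceable? : Unary.Decidable (Balanceable Σ)
    balanceable? k = map′ fwd bwd
      (searchVec (searchVec searchΩ k) order
        (λ zs → ∀V? (λ u → ∀V? (good? (lookup zs ∘ to) u))))
      where
      Goods : Vec (Vec Ω k) order → Set
      Goods zs = ∀ u v → Good (lookup zs ∘ to) u v

      fwd : ∃ Goods → Balanceable Σ k
      fwd (zs , g) = good⇒balanceable (lookup zs ∘ to) g

      bwd : Balanceable Σ k → ∃ Goods
      bwd (Z , pos) = tabulate (ζ ∘ from) , λ u v p →
        subst (λ x → ⟨ x , _ ⟩ ≢ 0ℤ × σ p Sign.* ℤ.sign ⟨ x , _ ⟩ ≡ Sign.+)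
          (sym (eq u))
          (subst (λ y → ⟨ ζ u , y ⟩ ≢ 0ℤ ×
                        σ p Sign.* ℤ.sign ⟨ ζ u , y ⟩ ≡ Sign.+)
            (sym (eq v)) (nonzero p , pos p))
        where
        open SwitchingFunction Z
        eq : ∀ v → lookup (tabulate (ζ ∘ from)) (to v) ≡ ζ v
        eq v = trans (lookup∘tabulate (ζ ∘ from) (to v))
                     (cong ζ (strictlyInverseʳ v))

    signΩ : Sign → Ω
    signΩ Sign.- = -1Ω
    signΩ Sign.+ = 1Ω

    coord : V → V × V → Ω
    coord w (i , j) with i ~? j | w ≟ i | w ≟ j
    ... | no _  | _     | _     = 0Ω
    ... | yes _ | yes _ | _     = 1Ω
    ... | yes p | no _  | yes _ = signΩ (σ p)
    ... | yes _ | no _  | no _  = 0Ω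

    prod : V → V → V × V → ℤ
    prod u v e = toℤ (coord u e) ℤ.* toℤ (coord v e)

    1*signΩ : ∀ s → 1ℤ ℤ.* toℤ (signΩ s) ≡ s ◃ 1
    1*signΩ Sign.- = refl
    1*signΩ Sign.+ = refl

    signΩ*1 : ∀ s → toℤ (signΩ s) ℤ.* 1ℤ ≡ s ◃ 1
    signΩ*1 Sign.- = refl
    signΩ*1 Sign.+ = refl

    prod-term : ∀ {u v} (p : u ~ v) e → prod u v e ≡ 0ℤ ⊎ prod u v e ≡ σ p ◃ 1
    prod-term {u} {v} p (i , j)
      with i ~? j | u ≟ i | u ≟ j | v ≟ i | v ≟ j
    ... | no _  | _        | _        | _        | _        = inj₁ refl
    ... | yes _ | yes refl | _        | yes refl | _        =
      ⊥-elim (~-irrefl p)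
    ... | yes q | yes refl | _        | no _     | yes refl =
      inj₂ (trans (1*signΩ (σ q)) (cong (_◃ 1) (σ-irr q p)))
    ... | yes _ | yes refl | _        | no _     | no _     = inj₁ refl
    ... | yes q | no _     | yes refl | yes refl | _        =
      inj₂ (trans (signΩ*1 (σ q)) (cong (_◃ 1) (σ-sym q p)))
    ... | yes _ | no _     | yes refl | no _     | yes refl =
      ⊥-elim (~-irrefl p)
    ... | yes q | no _     | yes refl | no _     | no _     =
      inj₁ (ℤ.*-zeroʳ (toℤ (signΩ (σ q))))
    ... | yes _ | no _     | no _     | _        | _        = inj₁ refl

    prod-self : ∀ {u v} (p : u ~ v) → prod u v (u , v) ≡ σ p ◃ 1
    prod-self {u} {v} p with u ~? v | u ≟ u | v ≟ u | v ≟ v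
    ... | no ¬p | _      | _        | _      = contradiction p ¬p
    ... | yes _ | no u≢u | _        | _      = contradiction refl u≢u
    ... | yes _ | yes _  | yes refl | _      = ⊥-elim (~-irrefl p)
    ... | yes _ | yes _  | no _     | no v≢v = contradiction refl v≢v
    ... | yes q | yes _  | no _     | yes _  =
      trans (1*signΩ (σ q)) (cong (_◃ 1) (σ-irr q p))

    inner : ∀ {m u v} (p : u ~ v) (es : Vec (V × V) m) →
            ∃ λ c → ⟨ map (coord u) es , map (coord v) es ⟩ ≡ σ p ◃ c
    inner p [] = 0 , refl
    inner p (e ∷ es) with prod-term p e | inner p es
    ... | inj₁ z | c , eq = c , trans (cong₂ ℤ._+_ z eq) (ℤ.+-identityˡ _)
    ... | inj₂ t | c , eq = suc c , trans (cong₂ ℤ._+_ t eq) (◃-suc (σ p) c)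

    inner-suc : ∀ {m u v} (p : u ~ v) (es : Vec (V × V) m) → (u , v) ∈ es →
                ∃ λ c → ⟨ map (coord u) es , map (coord v) es ⟩ ≡ σ p ◃ suc c
    inner-suc p (_ ∷ es) (here refl) with inner p es
    ... | c , eq = c , trans (cong₂ ℤ._+_ (prod-self p) eq) (◃-suc (σ p) c)
    inner-suc p (e ∷ es) (there i) with prod-term p e | inner-suc p es i
    ... | inj₁ z | c , eq = c , trans (cong₂ ℤ._+_ z eq) (ℤ.+-identityˡ _)
    ... | inj₂ t | c , eq =
      suc c , trans (cong₂ ℤ._+_ t eq) (◃-suc (σ p) (suc c))

    pairs : Vec (V × V) (order ℕ.* order)
    pairs = allPairs (tabulate from) (tabulate from)

    ∈-pairs : ∀ u v → (u , v) ∈ pairs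
    ∈-pairs u v = ∈-allPairs⁺ (∈-all u) (∈-all v)
      where
      ∈-all : ∀ w → w ∈ tabulate from
      ∈-all w = subst (_∈ tabulate from) (strictlyInverseʳ w)
                      (∈-tabulate⁺ from (to w))

    balanceable-order² : Balanceable Σ (suc (order ℕ.* order))
    balanceable-order² = good⇒balanceable ζ good
      where
      ζ : V → Vec Ω (suc (order ℕ.* order))
      ζ w = 0Ω ∷ map (coord w) pairs

      ◃-good : ∀ s c {x} → x ≡ s ◃ suc c →
               x ≢ 0ℤ × s Sign.* ℤ.sign x ≡ Sign.+
      ◃-good Sign.- c refl = (λ ()) , refl
      ◃-good Sign.+ c refl = (λ ()) , refl

      good : ∀ u v → Good ζ u v
      good u v p with inner-suc p pairs (∈-pairs u v)
      ... | c , eq = ◃-good (σ p) c (trans (ℤ.+-identityˡ _) eq)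

bdim-exists : ∀ {G} (Σ : SignedGraph G) → ∃ (IsBdim Σ)
bdim-exists Σ
  with least (λ k → (1 ℕ.≤? k) ×-dec balanceable? Σ k) _
             (s≤s z≤n , balanceable-order² Σ)
... | k , (1≤k , b) , min =
  k , record { positive = 1≤k ; balanceable = b
             ; minimal = λ j 1≤j bj → min j (1≤j , bj) }

bdim : ∀ {G} → SignedGraph G → ℕ
bdim Σ = proj₁ (bdim-exists Σ)

{-# OPTIONS --safe #-}
-- A connected balanced signed graph has a potential: signs θ on the vertices
-- with σ₁(uu′) = θ(u) θ(u′).  If ζ balances Σ₂ in dimension k, then
-- (u , v) ↦ θ(u) ζ(v) balances Σ₁ ⋆ Σ₂ in the same dimension, as soon as ζ has
-- no zero value: this is needed for the edges between (u , v) and (u′ , v), and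
-- can be arranged since a zero value only occurs at an isolated vertex.
-- Conversely, Σ₂ is the restriction of Σ₁ ⋆ Σ₂ to any fibre over G₁.
module Submission where

open import Defs
open import Data.Fin.Base using (Fin)
import Data.Fin.Properties as Fin
open import Data.Integer.Base as ℤ using (ℤ; +_; 0ℤ; 1ℤ; _◃_)
import Data.Integer.Properties as ℤ
open import Data.List.Membership.Propositional using () renaming (_∈_ to _∈ˡ_)
import Data.List.Membership.DecPropositional as DecMembership
open import Data.List.Relation.Unary.All as All using (All; []; _∷_)
open import Data.List.Relation.Unary.All.Properties using (¬Any⇒All¬)
open import Data.List.Relation.Unary.AllPairs using ([]; _∷_)
open import Data.List.Relation.Unary.Any using (here; there)
open import Data.List.Relation.Unary.Unique.Propositional using (Unique)
open import Data.Nat.Base using (ℕ; zero; suc; _≤_; z≤n; s≤s; NonZero)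
import Data.Nat.Properties as ℕ
open import Data.Product.Base using (∃; ∃-syntax; _×_; _,_; proj₁; proj₂)
open import Data.Sign.Base as Sign using (Sign)
import Data.Sign.Properties as Sign
open import Data.Sum.Base using (inj₁; inj₂)
open import Data.Vec.Base using (Vec; []; _∷_; map; replicate)
open import Relation.Binary.Construct.Closure.ReflexiveTransitive
  using (ε; _◅_; _◅◅_)
open import Relation.Binary.PropositionalEquality
open import Relation.Nullary.Decidable using (yes; no; decidable-stable)
open import Relation.Nullary.Negation using (¬_; contradiction)

-- Arithmetic of signs.

s*t≡+⇒t≡s : ∀ s t → s Sign.* t ≡ Sign.+ → t ≡ s
s*t≡+⇒t≡s Sign.+ Sign.+ _ = refl
s*t≡+⇒t≡s Sign.- Sign.- _ = refl

≢-⇒≡+ : ∀ {s} → s ≢ Sign.- → s ≡ Sign.+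
≢-⇒≡+ {Sign.+} _   = refl
≢-⇒≡+ {Sign.-} s≢- = contradiction refl s≢-

-- Balanced signed graphs

module _ {G : Graph} (Σ : SignedGraph G) where
  open Graph G
  open SignedGraph Σ
  open DecMembership _≟_ using (_∈?_)

  walkSign-◅◅ : ∀ {u v w} (a : Walk u v) (b : Walk v w) →
                walkSign (a ◅◅ b) ≡ walkSign a Sign.* walkSign b
  walkSign-◅◅ ε       b = refl
  walkSign-◅◅ (p ◅ a) b =
    trans (cong (σ p Sign.*_) (walkSign-◅◅ a b)) (sym (Sign.*-assoc (σ p) _ _))

  -- Cuts a path at one of its vertices. The inclusion `before-⊆` is phrased through predicates
  -- because freshness of a prepended vertex is an `All` statement, which can then be passed
  -- directly to `before`.
  record Split {u v} (x : V) (w : Walk u v) : Set₁ where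
    field
      before        : Walk u x
      after         : Walk x v
      sign          : walkSign w ≡ walkSign before Sign.* walkSign after
      before-unique : Unique (vertices before)
      after-unique  : Unique (vertices after)
      before-⊆      : ∀ {P : V → Set} → All P (vertices w) → All P (vertices before)

  split-here : ∀ {u v} (w : Walk u v) → Unique (vertices w) → Split u w
  split-here {u} w unique = record
    { before = ε ; after = w ; sign = refl
    ; before-unique = [] ∷ [] ; after-unique = unique
    ; before-⊆ = λ all → head w all ∷ [] }
    where
    head : ∀ {v} (w : Walk u v) {P : V → Set} → All P (vertices w) → P u
    head ε       (px ∷ _) = px
    head (_ ◅ _) (px ∷ _) = px

  split : ∀ {u v x} (w : Walk u v) → Unique (vertices w) → x ∈ˡ vertices w →
          Split x w
  split ε       unique (here refl) = split-here ε unique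
  split (p ◅ w) unique (here refl) = split-here (p ◅ w) unique
  split (p ◅ w) (fresh ∷ unique) (there x∈w) = record
    { before = p ◅ before ; after = after
    ; sign = trans (cong (σ p Sign.*_) sign) (sym (Sign.*-assoc (σ p) _ _))
    ; before-unique = before-⊆ fresh ∷ before-unique
    ; after-unique = after-unique
    ; before-⊆ = λ { (px ∷ all) → px ∷ before-⊆ all } }
    where open Split (split w unique x∈w)

  end∈vertices : ∀ {u v} (w : Walk u v) → v ∈ˡ vertices w
  end∈vertices ε       = here refl
  end∈vertices (_ ◅ w) = there (end∈vertices w)

  closed-path-positive : ∀ {v} (w : Walk v v) → Unique (vertices w) →
                         walkSign w ≡ Sign.+
  closed-path-positive ε       _           = refl
  closed-path-positive (_ ◅ w) (fresh ∷ _) =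
    contradiction refl (All.lookup fresh (end∈vertices w))

  module _ (balanced : Balanced Σ) where

    -- A path of length one goes back along the same edge, so its sign is squared; a longer one
    -- closes up to a genuine cycle, which is positive by balance.
    closed-up-path-positive : ∀ {u v} (p : u ~ v) (w : Walk v u) →
                              Unique (vertices w) →
                              σ p Sign.* walkSign w ≡ Sign.+
    closed-up-path-positive p ε _ = contradiction p ~-irrefl
    closed-up-path-positive p (q ◅ ε) _ =
      trans (cong₂ Sign._*_ (σ-sym p q) (Sign.*-identityʳ (σ q))) (Sign.s*s≡+ (σ q))
    closed-up-path-positive p w@(_ ◅ _ ◅ _) unique =
      ≢-⇒≡+ λ negative → balanced
        (record { path = w ; distinct = unique ; long = s≤s (s≤s z≤n) ; closing = p }
        , negative)

    path-of-same-sign : ∀ {u v} (w : Walk u v) →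
      ∃[ w′ ] Unique (vertices {u} {v} w′) × walkSign w ≡ walkSign w′
    path-of-same-sign ε = ε , [] ∷ [] , refl
    path-of-same-sign {u} (p ◅ w) with path-of-same-sign w
    ... | w′ , unique , eq with u ∈? vertices w′
    ...   | no u∉w′  = p ◅ w′ , ¬Any⇒All¬ _ u∉w′ ∷ unique , cong (σ p Sign.*_) eq
    ...   | yes u∈w′ = after , after-unique , (begin
      σ p Sign.* walkSign w                              ≡⟨ cong (σ p Sign.*_) (trans eq sign) ⟩
      σ p Sign.* (walkSign before Sign.* walkSign after) ≡⟨ Sign.*-assoc (σ p) _ _ ⟨
      σ p Sign.* walkSign before Sign.* walkSign after   ≡⟨ cong (Sign._* _) (closed-up-path-positive p before before-unique) ⟩
      walkSign after                                     ∎)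
      where
      open ≡-Reasoning
      open Split (split w′ unique u∈w′)

    closed-walk-positive : ∀ {v} (w : Walk v v) → walkSign w ≡ Sign.+
    closed-walk-positive w with path-of-same-sign w
    ... | w′ , unique , eq = trans eq (closed-path-positive w′ unique)

    -- The potential at `u` is the sign of a chosen walk from the root. As closed walks are
    -- positive, every walk from `u` back to the root has that same sign.
    potential : Connected G → ∃[ θ ] (∀ {u v} (p : u ~ v) → σ p ≡ θ u Sign.* θ v)
    potential (root , walk) = θ , σ≡θθ
      where
      θ : V → Sign
      θ v = walkSign (walk root v)

      θ≡back : ∀ {u} (a : Walk u root) → walkSign a ≡ θ u
      θ≡back {u} a = s*t≡+⇒t≡s (θ u) (walkSign a)
        (trans (sym (walkSign-◅◅ (walk root u) a)) (closed-walk-positive (walk root u ◅◅ a)))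

      σ≡θθ : ∀ {u v} (p : u ~ v) → σ p ≡ θ u Sign.* θ v
      σ≡θθ {u} {v} p = begin
        σ p                          ≡⟨ Sign.*-identityʳ (σ p) ⟨
        σ p Sign.* Sign.+            ≡⟨ cong (σ p Sign.*_) (Sign.s*s≡+ (θ v)) ⟨
        σ p Sign.* (θ v Sign.* θ v)  ≡⟨ Sign.*-assoc (σ p) (θ v) (θ v) ⟨
        -- One factor `θ v` becomes the sign of a walk from `v` to the root, so that prepending `p`
        -- gives a walk from `u` to the root.
        σ p Sign.* θ v Sign.* θ v    ≡⟨ cong (λ s → σ p Sign.* s Sign.* θ v) (θ≡back (walk v root)) ⟨
        walkSign (p ◅ walk v root) Sign.* θ v ≡⟨ cong (Sign._* θ v) (θ≡back (p ◅ walk v root)) ⟩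
        θ u Sign.* θ v               ∎
        where open ≡-Reasoning

-- Inner products on Ω

-- Since `ℤ.sign 0ℤ` is `Sign.+`, the sign alone does not exclude zero; the `suc` records
-- nonvanishing together with the sign.
HasSign : Sign → ℤ → Set
HasSign s i = ∃[ m ] i ≡ s ◃ suc m

HasSign⇒≢0 : ∀ {s i} → HasSign s i → i ≢ 0ℤ
HasSign⇒≢0 {Sign.+} (_ , refl) ()
HasSign⇒≢0 {Sign.-} (_ , refl) ()

HasSign⇒sign : ∀ {s i} → HasSign s i → ℤ.sign i ≡ s
HasSign⇒sign {s} (m , refl) = ℤ.sign-◃ s (suc m)

≢0⇒HasSign : ∀ {i} → i ≢ 0ℤ → HasSign (ℤ.sign i) i
≢0⇒HasSign {+ zero}      i≢0 = contradiction refl i≢0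
≢0⇒HasSign {+ suc m}     _   = m , refl
≢0⇒HasSign {ℤ.-[1+ m ]}  _   = m , refl

HasSign-* : ∀ s t {i j} → HasSign s i → HasSign t j → HasSign (s Sign.* t) (i ℤ.* j)
HasSign-* s t (m , refl) (n , refl) =
  _ , sym (ℤ.◃-distrib-* s t (suc m) (suc n))

infixr 7 _·_ _·ᵥ_

_·_ : Sign → Ω → Ω
Sign.+ · a   = a
Sign.- · -1Ω = 1Ω
Sign.- · 0Ω  = 0Ω
Sign.- · 1Ω  = -1Ω

toℤ-· : ∀ s a → toℤ (s · a) ≡ (s ◃ 1) ℤ.* toℤ a
toℤ-· Sign.+ a   = sym (ℤ.*-identityˡ (toℤ a))
toℤ-· Sign.- -1Ω = refl
toℤ-· Sign.- 0Ω  = refl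
toℤ-· Sign.- 1Ω  = refl

_·ᵥ_ : ∀ {k} → Sign → Vec Ω k → Vec Ω k
s ·ᵥ x = map (s ·_) x

⟨·ᵥ,⟩ : ∀ s {k} (x y : Vec Ω k) → ⟨ s ·ᵥ x , y ⟩ ≡ (s ◃ 1) ℤ.* ⟨ x , y ⟩
⟨·ᵥ,⟩ s []      []      = sym (ℤ.*-zeroʳ (s ◃ 1))
⟨·ᵥ,⟩ s (a ∷ x) (b ∷ y) = begin
  toℤ (s · a) ℤ.* toℤ b ℤ.+ ⟨ s ·ᵥ x , y ⟩
    ≡⟨ cong₂ (λ i j → i ℤ.* toℤ b ℤ.+ j) (toℤ-· s a) (⟨·ᵥ,⟩ s x y) ⟩
  (s ◃ 1) ℤ.* toℤ a ℤ.* toℤ b ℤ.+ (s ◃ 1) ℤ.* ⟨ x , y ⟩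
    ≡⟨ cong (ℤ._+ (s ◃ 1) ℤ.* ⟨ x , y ⟩) (ℤ.*-assoc (s ◃ 1) (toℤ a) (toℤ b)) ⟩
  (s ◃ 1) ℤ.* (toℤ a ℤ.* toℤ b) ℤ.+ (s ◃ 1) ℤ.* ⟨ x , y ⟩
    ≡⟨ ℤ.*-distribˡ-+ (s ◃ 1) (toℤ a ℤ.* toℤ b) ⟨ x , y ⟩ ⟨
  (s ◃ 1) ℤ.* (toℤ a ℤ.* toℤ b ℤ.+ ⟨ x , y ⟩) ∎
  where open ≡-Reasoning

-- Both scalars come out of the inner product, the second one after exchanging its arguments.
HasSign-·ᵥ : ∀ {r k} s t (x y : Vec Ω k) → HasSign r ⟨ x , y ⟩ →
             HasSign (s Sign.* t Sign.* r) ⟨ s ·ᵥ x , t ·ᵥ y ⟩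
HasSign-·ᵥ s t x y h =
  subst₂ HasSign (sym (Sign.*-assoc s t _)) (sym eq)
    (HasSign-* s _ (s◃1 s) (HasSign-* t _ (s◃1 t) h))
  where
  open ≡-Reasoning
  s◃1 : ∀ s → HasSign s (s ◃ 1)
  s◃1 s = 0 , refl

  eq : ⟨ s ·ᵥ x , t ·ᵥ y ⟩ ≡ (s ◃ 1) ℤ.* ((t ◃ 1) ℤ.* ⟨ x , y ⟩)
  eq = begin
    ⟨ s ·ᵥ x , t ·ᵥ y ⟩                 ≡⟨ ⟨·ᵥ,⟩ s x (t ·ᵥ y) ⟩
    (s ◃ 1) ℤ.* ⟨ x , t ·ᵥ y ⟩          ≡⟨ cong ((s ◃ 1) ℤ.*_) (⟨⟩-comm x (t ·ᵥ y)) ⟩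
    (s ◃ 1) ℤ.* ⟨ t ·ᵥ y , x ⟩          ≡⟨ cong ((s ◃ 1) ℤ.*_) (⟨·ᵥ,⟩ t y x) ⟩
    (s ◃ 1) ℤ.* ((t ◃ 1) ℤ.* ⟨ y , x ⟩) ≡⟨ cong (λ i → (s ◃ 1) ℤ.* ((t ◃ 1) ℤ.* i)) (⟨⟩-comm y x) ⟩
    (s ◃ 1) ℤ.* ((t ◃ 1) ℤ.* ⟨ x , y ⟩) ∎

-- Serves both as a decidable test for the zero vector and as the squared norm.
weight : ∀ {k} → Vec Ω k → ℕ
weight []        = 0
weight (0Ω  ∷ x) = weight x
weight (-1Ω ∷ x) = suc (weight x)
weight (1Ω  ∷ x) = suc (weight x)

⟨x,x⟩≡weight : ∀ {k} (x : Vec Ω k) → ⟨ x , x ⟩ ≡ + weight x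
⟨x,x⟩≡weight []        = refl
⟨x,x⟩≡weight (0Ω  ∷ x) = trans (ℤ.+-identityˡ _) (⟨x,x⟩≡weight x)
⟨x,x⟩≡weight (-1Ω ∷ x) = cong (λ i → 1ℤ ℤ.+ i) (⟨x,x⟩≡weight x)
⟨x,x⟩≡weight (1Ω  ∷ x) = cong (λ i → 1ℤ ℤ.+ i) (⟨x,x⟩≡weight x)

weight≡0⇒⟨x,y⟩≡0 : ∀ {k} (x y : Vec Ω k) → weight x ≡ 0 → ⟨ x , y ⟩ ≡ 0ℤ
weight≡0⇒⟨x,y⟩≡0 []       []      _  = refl
weight≡0⇒⟨x,y⟩≡0 (0Ω ∷ x) (_ ∷ y) eq =
  trans (ℤ.+-identityˡ _) (weight≡0⇒⟨x,y⟩≡0 x y eq)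

weight≢0⇒⟨x,x⟩-positive : ∀ {k} (x : Vec Ω k) → weight x ≢ 0 →
                          HasSign Sign.+ ⟨ x , x ⟩
weight≢0⇒⟨x,x⟩-positive x w≢0 with weight x | ⟨x,x⟩≡weight x
... | zero  | _  = contradiction refl w≢0
... | suc m | eq = m , eq

-- Balancing

module _ {G : Graph} (Σ : SignedGraph G) where
  open Graph G
  open SignedGraph Σ

  -- Signs are self-inverse, so a switched edge is positive exactly when its inner product has the
  -- original sign of the edge.
  Represents : ∀ {k} → (V → Vec Ω k) → Set
  Represents ζ = ∀ {u v} (p : u ~ v) → HasSign (σ p) ⟨ ζ u , ζ v ⟩

  represents⇒balanceable : ∀ {k} (ζ : V → Vec Ω k) → Represents ζ → Balanceable Σ k
  represents⇒balanceable ζ rep =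
    record { ζ = ζ ; nonzero = λ p → HasSign⇒≢0 (rep p) } ,
    λ p → trans (cong (σ p Sign.*_) (HasSign⇒sign (rep p))) (Sign.s*s≡+ (σ p))

  balanceable⇒represents : ∀ {k} → Balanceable Σ k → ∃ (Represents {k})
  balanceable⇒represents (Z , positive) = ζ , λ p →
    subst (λ s → HasSign s _) (s*t≡+⇒t≡s (σ p) _ (positive p))
      (≢0⇒HasSign (nonzero p))
    where open SwitchingFunction Z

  -- Zero vectors sit at isolated vertices only, so they can be replaced.
  represents-nonzero : ∀ {k} → Balanceable Σ (suc k) →
    ∃[ ζ ] Represents {suc k} ζ × (∀ v → weight (ζ v) ≢ 0)
  represents-nonzero {k} bal = ζ′ , rep′ , λ v → fix-nonzero (ζ v)
    where
    ζ   = proj₁ (balanceable⇒represents bal)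
    rep = proj₂ (balanceable⇒represents bal)

    fix : Vec Ω (suc k) → Vec Ω (suc k)
    fix x with weight x ℕ.≟ 0
    -- The all-ones vector has nonzero weight because the dimension is positive.
    ... | yes _ = replicate (suc k) 1Ω
    ... | no  _ = x

    fix-nonzero : ∀ x → weight (fix x) ≢ 0
    fix-nonzero x with weight x ℕ.≟ 0
    ... | yes _  = λ ()
    ... | no w≢0 = w≢0

    fix-id : ∀ x y → ⟨ x , y ⟩ ≢ 0ℤ → fix x ≡ x
    fix-id x y xy≢0 with weight x ℕ.≟ 0
    ... | yes w≡0 = contradiction (weight≡0⇒⟨x,y⟩≡0 x y w≡0) xy≢0
    ... | no _    = refl

    ζ′ : V → Vec Ω (suc k)
    ζ′ v = fix (ζ v)

    ζ′≡ζ : ∀ {u v} → u ~ v → ζ′ u ≡ ζ u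
    ζ′≡ζ {u} {v} p = fix-id (ζ u) (ζ v) (HasSign⇒≢0 (rep p))

    rep′ : Represents ζ′
    rep′ p = subst₂ (λ x y → HasSign (σ p) ⟨ x , y ⟩)
      (sym (ζ′≡ζ p)) (sym (ζ′≡ζ (~-sym p))) (rep p)

-- The least dimension for `Σ` also balances `T`. It is at least 1, so only dimensions `suc k` have
-- to be transferred.
bdim-anti : ∀ {G H} (Σ : SignedGraph G) (T : SignedGraph H) →
            (∀ {k} → Balanceable Σ (suc k) → Balanceable T (suc k)) →
            bdim T ≤ bdim Σ
bdim-anti Σ T f with bdim Σ | proj₂ (bdim-exists Σ)
... | zero  | record { positive = () }
... | suc k | isBdim =
  IsBdim.minimal (proj₂ (bdim-exists T)) (suc k) (s≤s z≤n)
    (f (IsBdim.balanceable isBdim))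

-- Balancing the BCD-lexicographic product.

module _ {G₁ G₂ : Graph} (Σ₁ : SignedGraph G₁) (Σ₂ : SignedGraph G₂) where
  private
    module G₁ = Graph G₁
    module G₂ = Graph G₂
    module Σ₁ = SignedGraph Σ₁
    module Σ₂ = SignedGraph Σ₂

  -- Across fibres the factor `θ u θ u′` supplies the sign from `Σ₁`; over a non-adjacent pair in
  -- `G₂` nothing else may contribute, whence the demand for positive inner products there. Inside a
  -- fibre the factor is a square and cancels.
  ⋆-represents : ∀ {k} (θ : G₁.V → Sign) (ζ : G₂.V → Vec Ω k) →
    (∀ {u u′} (p : u G₁.~ u′) → Σ₁.σ p ≡ θ u Sign.* θ u′) →
    Represents Σ₂ ζ →
    (∀ {v v′} → ¬ v G₂.~ v′ → HasSign Sign.+ ⟨ ζ v , ζ v′ ⟩) →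
    Represents (Σ₁ ⋆ Σ₂) (λ (u , v) → θ u ·ᵥ ζ v)
  ⋆-represents θ ζ pot rep nonadj {u , v} {u′ , v′} (inj₁ p) with v G₂.~? v′
  ... | yes q = subst (λ s → HasSign (s Sign.* _) _) (sym (pot p))
                  (HasSign-·ᵥ (θ u) (θ u′) (ζ v) (ζ v′) (rep q))
  ... | no ¬q = subst (λ s → HasSign s _)
                  (trans (Sign.*-identityʳ _) (sym (pot p)))
                  (HasSign-·ᵥ (θ u) (θ u′) (ζ v) (ζ v′) (nonadj ¬q))
  ⋆-represents θ ζ pot rep nonadj {u , v} {_ , v′} (inj₂ (refl , q)) =
    subst (λ s → HasSign (s Sign.* Σ₂.σ q) ⟨ θ u ·ᵥ ζ v , θ u ·ᵥ ζ v′ ⟩)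
      (Sign.s*s≡+ (θ u))
      (HasSign-·ᵥ (θ u) (θ u) (ζ v) (ζ v′) (rep q))

  balanceable-fibre : ∀ {k} → G₁.V → Balanceable (Σ₁ ⋆ Σ₂) k → Balanceable Σ₂ k
  balanceable-fibre u bal with balanceable⇒represents (Σ₁ ⋆ Σ₂) bal
  ... | ζ , rep = represents⇒balanceable Σ₂ (λ v → ζ (u , v))
                    -- An edge of the form `inj₂` stays in the fibre over `u`, and its sign in the
                    -- product is that of `q` by definition.
                    (λ q → rep (inj₂ (refl , q)))

theorem2p24 : (G₁ : Graph) (Σ₁ : SignedGraph G₁) (n : ℕ) → .{{_ : NonZero n}} →
    (Σ₂ : SignedGraph (K n)) →
    Connected G₁ → Balanced Σ₁ →
    bdim (Σ₁ ⋆ Σ₂) ≡ bdim Σ₂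
theorem2p24 G₁ Σ₁ n Σ₂ connected balanced = ℕ.≤-antisym
  (bdim-anti Σ₂ (Σ₁ ⋆ Σ₂) extend)
  (bdim-anti (Σ₁ ⋆ Σ₂) Σ₂ (balanceable-fibre Σ₁ Σ₂ (proj₁ connected)))
  where
  extend : ∀ {k} → Balanceable Σ₂ (suc k) → Balanceable (Σ₁ ⋆ Σ₂) (suc k)
  extend bal with potential Σ₁ balanced connected | represents-nonzero Σ₂ bal
  ... | θ , pot | ζ , rep , nonzero =
    represents⇒balanceable (Σ₁ ⋆ Σ₂) (λ (u , v) → θ u ·ᵥ ζ v)
      (⋆-represents Σ₁ Σ₂ θ ζ pot rep nonadjacent)
    where
    -- In a complete graph only equal vertices are non-adjacent, so the inner product is the squared
    -- norm of a nonzero vector.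
    nonadjacent : ∀ {v v′ : Fin n} → ¬ (v ≢ v′) → HasSign Sign.+ ⟨ ζ v , ζ v′ ⟩
    nonadjacent {v} {v′} ¬v≢v′ with decidable-stable (v Fin.≟ v′) ¬v≢v′
    ... | refl = weight≢0⇒⟨x,x⟩-positive (ζ v) (nonzero v)
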